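{- Let $n$ and $d$ be positive integers, $n \geq 2$, $d \geq 3$. Then there exists a positive integer $r$ such that there is a tree where the centre of the largest $r$-star is a vertex of degree $n$ and at distance at least $d$ from every leaf.
   Context: Graphs are simple and undirected. An independent set of a graph is a set of pairwise non-adjacent vertices. For a graph $G$, an integer $r \geq 1$ and a vertex $v$ of $G$, $\mathcal{I}^{(r)}_v(G)$ denotes the family of all independent sets of $G$ of cardinality $r$ that contain $v$; this family is called an $r$-star of $G$, and $v$ is its centre. The size of an $r$-star is the number of independent sets in it. A leaf of a tree is a vertex of degree 1. -}

module Defs where

open import Data.Fin.Base using (Fin)
open import Data.Fin.Properties using (all?)
open import Data.Fin.Subset using (Subset; inside; outside; _∈_; ∣_∣)
open import Data.Fin.Subset.Properties using (_∈?_)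
open import Data.List.Base using (List; []; _∷_; _++_; map; filter; length)
open import Data.List.Relation.Unary.Linked using (Linked)
open import Data.List.Relation.Unary.Unique.Propositional using (Unique)
open import Data.Nat.Base using (ℕ; zero; suc; _≤_; _<_; NonZero)
open import Data.Nat.Properties using (_≟_)
open import Data.Product.Base using (∃-syntax; _×_)
open import Data.Vec.Base as Vec using (tabulate)
open import Level using (0ℓ)
open import Relation.Binary.Core using (Rel)
open import Relation.Binary.Definitions using (Decidable; Symmetric)
open import Relation.Binary.PropositionalEquality.Core using (_≡_; _≢_)
open import Relation.Nullary.Decidable using (does; ¬?; _×-dec_; _→-dec_)
open import Relation.Nullary.Negation using (¬_)
import Relation.Unary as U

-- Finite simple graphs, with vertex set Fin order.
record Graph : Set₁ where
  field
    order  : ℕ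
    Adj    : Rel (Fin order) 0ℓ
    adj?   : Decidable Adj
    sym    : Symmetric Adj
    irrefl : ∀ {u} → ¬ Adj u u

  Vertex : Set
  Vertex = Fin order

-- Every subset of Fin n occurs exactly once in this list.
subsets : ∀ n → List (Subset n)
subsets zero    = Vec.[] ∷ []
subsets (suc n) = map (inside Vec.∷_) (subsets n) ++ map (outside Vec.∷_) (subsets n)

module _ (G : Graph) where
  open Graph G

  neighbourhood : Vertex → Subset order
  neighbourhood v = tabulate (λ u → does (adj? v u))

  degree : Vertex → ℕ
  degree v = ∣ neighbourhood v ∣

  IsLeaf : Vertex → Set
  IsLeaf v = degree v ≡ 1

  data Walk : Vertex → Vertex → ℕ → Set where
    []  : ∀ {u} → Walk u u 0
    _∷_ : ∀ {u v w k} → Adj u v → Walk v w k → Walk u w (suc k)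

  IsDistance : Vertex → Vertex → ℕ → Set
  IsDistance u v k = Walk u v k × (∀ {j} → Walk u v j → k ≤ j)

  DistanceAtLeast : ℕ → Vertex → Vertex → Set
  DistanceAtLeast d u v = ∃[ k ] IsDistance u v k × d ≤ k

  Connected : Set
  Connected = ∀ u v → ∃[ k ] Walk u v k

  -- A cycle is listed as x , y , z , ws with its first vertex x repeated at the
  -- end for adjacency, but not for distinctness; so its length is at least 3.
  record Cycle : Set where
    field
      x y z    : Vertex
      ws       : List Vertex
      distinct : Unique (x ∷ y ∷ z ∷ ws)
      closed   : Linked Adj (x ∷ y ∷ z ∷ ws ++ x ∷ [])

  record IsTree : Set where
    field
      nonEmpty  : NonZero order
      connected : Connected
      acyclic   : ¬ Cycle

  Independent : Subset order → Set
  Independent S = ∀ u v → u ∈ S → v ∈ S → ¬ Adj u v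

  independent? : U.Decidable Independent
  independent? S =
    all? λ u → all? λ v → (u ∈? S) →-dec ((v ∈? S) →-dec ¬? (adj? u v))

  InStar : ℕ → Vertex → Subset order → Set
  InStar r v S = Independent S × ∣ S ∣ ≡ r × v ∈ S

  inStar? : ∀ r v → U.Decidable (InStar r v)
  inStar? r v S = independent? S ×-dec ((∣ S ∣ ≟ r) ×-dec (v ∈? S))

  star : ℕ → Vertex → List (Subset order)
  star r v = filter (inStar? r v) (subsets order)

  starSize : ℕ → Vertex → ℕ
  starSize r v = length (star r v)

  -- The inequality is strict because "the largest r-star" is a unique one. The
  -- weak version would hold for every v as soon as r exceeds the order of G,
  -- all r-stars then being empty.
  IsCentreOfLargestStar : ℕ → Vertex → Set
  IsCentreOfLargestStar r v = ∀ w → w ≢ v → starSize r w < starSize r v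

{-# OPTIONS --safe #-}

-- Let the root v have n neighbours ("hubs"), each carrying k further branches, which are
-- paths on 2L vertices (so leaves are at distance 2L + 1 from v), and let r = nkL + 1.
-- An independent r-set containing v contains no hub and a maximum independent set of every
-- branch; with N = L + 1 such sets per branch, there are N^(nk) of them, and at least
-- N^(nk) / N avoid any given w ≠ v.  An independent r-set avoiding v must use a hub, which
-- forces its k branches down to a single maximum set, and it is deficient on at most n
-- branches; hence there are at most 2^n · N^(nk - k) · (1 + 4^L · nk)^n of them.  For k
-- large this is smaller than N^(nk) / N, so more r-sets contain v but not w than the reverse.
module Submission where

open import Data.Bool.Base using (Bool)
open import Data.Fin.Base
  using (Fin; zero; suc; toℕ; inject₁; combine; quotient; remQuot; splitAt; _↑ˡ_; _↑ʳ_)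
import Data.Fin.Properties as Fin
open import Data.Fin.Relation.Unary.Top using (view; ‵fromℕ; ‵inject₁)
open import Data.Fin.Subset using (Subset; inside; outside; ∣_∣; _∈_; _∉_; ⊥; ⊤)
open import Data.Fin.Subset.Properties
  using (_∈?_; ∉⊥; ∣⊥∣≡0; ∣⊤∣≡n; ∣p∣≤n; ⊆-antisym; x∈p⇒∣p-x∣<∣p∣; x∈p∧x≢y⇒x∈p-y)
open import Data.List.Base
  using (List; []; _∷_; _++_; map; length; filter; cartesianProductWith; concatMap)
open import Data.List.Membership.Propositional using () renaming (_∈_ to _∈ˡ_)
open import Data.List.Membership.Propositional.Properties
  using (∈-∃++; ∈-++⁻; ∈-++⁺ˡ; ∈-++⁺ʳ; ∈-map⁺; ∈-map⁻; ∈-filter⁺; ∈-filter⁻; ∈-concatMap⁺;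
         ∈-cartesianProductWith⁺; ∈-cartesianProductWith⁻)
open import Data.List.Properties using (length-++; length-map)
open import Data.List.Relation.Binary.Subset.Propositional using () renaming (_⊆_ to _⊆ˡ_)
open import Data.List.Relation.Unary.All as All using (All; []; _∷_)
open import Data.List.Relation.Unary.AllPairs using ([]; _∷_)
open import Data.List.Relation.Unary.Any as Any using (here; there)
open import Data.List.Relation.Unary.Linked using (Linked; _∷_)
open import Data.List.Relation.Unary.Unique.Propositional using (Unique)
import Data.List.Relation.Unary.Unique.Propositional.Properties as Unique
open import Data.Maybe.Base as Maybe using (Maybe; just; nothing)
open import Data.Maybe.Properties using (just-injective) renaming (≡-dec to ≡-decᵐ)
open import Data.Nat.Base
open import Data.Nat.Properties
open import Data.Nat.Solver using (module +-*-Solver)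
open import Data.Product.Base using (∃-syntax; Σ-syntax; _×_; _,_; proj₁; proj₂; uncurry)
open import Data.Sum.Base as Sum using (_⊎_; inj₁; inj₂; swap)
open import Data.Vec.Base as Vec
  using (Vec; []; _∷_; lookup; concat; replicate; _[_]≔_; here; there)
open import Data.Vec.Properties as Vec
  using (∷-injective; lookup-++ˡ; lookup-++ʳ; lookup-replicate; lookup-concat; lookup∘tabulate;
         lookup∘update; lookup∘update′; []=⇒lookup; lookup⇒[]=)
open import Relation.Binary.PropositionalEquality
open import Relation.Nullary.Decidable using (yes; no; does; dec-true; _⊎-dec_)
open import Relation.Nullary.Negation using (¬_; contradiction)
open import Defs

-- Counting with lists and subsets.

module _ {A : Set} where

  -- Each head of `xs` is cut out of `ys` once, and uniqueness of `xs` keeps the tail inside the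
  -- remainder. `ys` may repeat elements, so a crude covering list suffices for an upper bound.
  length-⊆ : ∀ {xs ys : List A} → Unique xs → xs ⊆ˡ ys → length xs ≤ length ys
  length-⊆ {[]}     _            _     = z≤n
  length-⊆ {x ∷ xs} (x∉xs ∷ uxs) xs⊆ys with ∈-∃++ (xs⊆ys (here refl))
  ... | ys₁ , ys₂ , refl = begin
    suc (length xs)                ≤⟨ s≤s (length-⊆ uxs xs⊆ys₁ys₂) ⟩
    suc (length (ys₁ ++ ys₂))      ≡⟨ cong suc (length-++ ys₁) ⟩
    suc (length ys₁ + length ys₂)  ≡⟨ +-suc (length ys₁) (length ys₂) ⟨
    length ys₁ + suc (length ys₂)  ≡⟨ length-++ ys₁ ⟨
    length (ys₁ ++ x ∷ ys₂)        ∎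
    where
    open ≤-Reasoning
    xs⊆ys₁ys₂ : xs ⊆ˡ ys₁ ++ ys₂
    xs⊆ys₁ys₂ y∈xs with ∈-++⁻ ys₁ (xs⊆ys (there y∈xs))
    ... | inj₁ p           = ∈-++⁺ˡ p
    ... | inj₂ (here refl) = contradiction refl (All.lookup x∉xs y∈xs)
    ... | inj₂ (there p)   = ∈-++⁺ʳ ys₁ p

  -- The factor `c` stands in for a division: a bound of the form `M / c` on each `f x` stays within
  -- the natural numbers.
  length-concatMap-≤ : ∀ {B : Set} (f : A → List B) c {M} xs → (∀ x → length (f x) * c ≤ M) →
                       length (concatMap f xs) * c ≤ length xs * M
  length-concatMap-≤ f c     []       bound = z≤n
  length-concatMap-≤ f c {M} (x ∷ xs) bound = begin
    length (f x ++ concatMap f xs) * c             ≡⟨ cong (_* c) (length-++ (f x)) ⟩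
    (length (f x) + length (concatMap f xs)) * c   ≡⟨ *-distribʳ-+ c (length (f x)) _ ⟩
    length (f x) * c + length (concatMap f xs) * c
      ≤⟨ +-mono-≤ (bound x) (length-concatMap-≤ f c xs bound) ⟩
    M + length xs * M                              ∎
    where open ≤-Reasoning

  length-cartesianProductWith : ∀ {B C : Set} (f : A → B → C) xs ys →
    length (cartesianProductWith f xs ys) ≡ length xs * length ys
  length-cartesianProductWith f []       ys = refl
  length-cartesianProductWith f (x ∷ xs) ys = begin
    length (map (f x) ys ++ cartesianProductWith f xs ys)
      ≡⟨ length-++ (map (f x) ys) ⟩
    length (map (f x) ys) + length (cartesianProductWith f xs ys)
      ≡⟨ cong₂ _+_ (length-map (f x) ys) (length-cartesianProductWith f xs ys) ⟩
    length ys + length xs * length ys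
      ∎
    where open ≡-Reasoning

∈-subsets : ∀ {n} (S : Subset n) → S ∈ˡ subsets n
∈-subsets []            = here refl
∈-subsets (inside  ∷ S) = ∈-++⁺ˡ (∈-map⁺ (inside ∷_) (∈-subsets S))
∈-subsets (outside ∷ S) = ∈-++⁺ʳ (map (inside ∷_) (subsets _)) (∈-map⁺ (outside ∷_) (∈-subsets S))

unique-subsets : ∀ n → Unique (subsets n)
unique-subsets zero    = All.[] ∷ []
unique-subsets (suc n) = Unique.++⁺
  (Unique.map⁺ (λ { refl → refl }) (unique-subsets n))
  (Unique.map⁺ (λ { refl → refl }) (unique-subsets n))
  λ (p , q) → heads (∈-map⁻ (inside ∷_) p) (∈-map⁻ (outside ∷_) q)
  where
  heads : ∀ {S : Subset (suc n)} → ∃[ P ] P ∈ˡ subsets n × S ≡ inside ∷ P →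
          ¬ (∃[ Q ] Q ∈ˡ subsets n × S ≡ outside ∷ Q)
  heads (_ , _ , refl) (_ , _ , ())

length-subsets : ∀ n → length (subsets n) ≡ 2 ^ n
length-subsets zero    = refl
length-subsets (suc n) = begin
  length (map (inside ∷_) S ++ map (outside ∷_) S) ≡⟨ length-++ (map (inside ∷_) S) ⟩
  length (map (inside ∷_) S) + length (map (outside ∷_) S)
    ≡⟨ cong₂ _+_ (length-map _ S) (length-map _ S) ⟩
  length S + length S                              ≡⟨ cong (λ l → l + l) (length-subsets n) ⟩
  2 ^ n + 2 ^ n                                    ≡⟨ cong (2 ^ n +_) (+-identityʳ (2 ^ n)) ⟨
  2 ^ suc n                                        ∎
  where
  open ≡-Reasoning
  S = subsets n

-- Exponentials outgrow polynomials.

m<2^m : ∀ m → m < 2 ^ m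
m<2^m zero    = s≤s z≤n
m<2^m (suc m) = begin-strict
  suc m          ≤⟨ m<2^m m ⟩
  2 ^ m          <⟨ m<m+n (2 ^ m) (m^n>0 2 m) ⟩
  2 ^ m + 2 ^ m  ≡⟨ cong (2 ^ m +_) (+-identityʳ (2 ^ m)) ⟨
  2 ^ suc m      ∎
  where open ≤-Reasoning

^-distribʳ-* : ∀ e m n → (m * n) ^ e ≡ m ^ e * n ^ e
^-distribʳ-* zero    m n = refl
^-distribʳ-* (suc e) m n = begin
  m * n * (m * n) ^ e      ≡⟨ cong (m * n *_) (^-distribʳ-* e m n) ⟩
  m * n * (m ^ e * n ^ e)  ≡⟨ solve 4 (λ m n a b → m :* n :* (a :* b) := m :* a :* (n :* b))
                                refl m n (m ^ e) (n ^ e) ⟩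
  m ^ suc e * n ^ suc e    ∎
  where
  open ≡-Reasoning
  open +-*-Solver

-- As `k` is `suc e * m`, `2 ^ k` splits into `e + 1` factors `2 ^ m`. One of them beats the
-- constant `C * a ^ e`, since `m` was chosen above it, and the other `e` beat `m ^ e`.
polynomial<exponential : ∀ C c e → ∃[ k ] 1 ≤ k × C * (1 + c * k) ^ e < 2 ^ k
polynomial<exponential C c e = suc e * m , s≤s z≤n , (begin-strict
  -- `1 ≤ k` bounds `1 + c * k` by `suc c * k`, which is a pure multiple of `m`.
  C * (1 + c * k) ^ e    ≤⟨ *-monoʳ-≤ C (^-monoˡ-≤ e (+-monoˡ-≤ (c * k) (s≤s z≤n))) ⟩
  C * (suc c * k) ^ e    ≡⟨ cong (λ z → C * z ^ e) (*-assoc (suc c) (suc e) m) ⟨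
  C * (a * m) ^ e        ≡⟨ cong (C *_) (^-distribʳ-* e a m) ⟩
  C * (a ^ e * m ^ e)    ≡⟨ *-assoc C (a ^ e) (m ^ e) ⟨
  C * a ^ e * m ^ e      ≤⟨ *-mono-≤ (n≤1+n (C * a ^ e)) (^-monoˡ-≤ e (<⇒≤ (m<2^m m))) ⟩
  m * (2 ^ m) ^ e        <⟨ *-monoˡ-< ((2 ^ m) ^ e) ⦃ m^n≢0 (2 ^ m) e ⦃ m^n≢0 2 m ⦄ ⦄ (m<2^m m) ⟩
  (2 ^ m) ^ suc e        ≡⟨ ^-*-assoc 2 m (suc e) ⟩
  2 ^ (m * suc e)        ≡⟨ cong (2 ^_) (*-comm m (suc e)) ⟩
  2 ^ k                  ∎)
  where
  open ≤-Reasoning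
  a = suc c * suc e
  m = suc (C * a ^ e)
  k = suc e * m


-- Vectors of choices with few exceptional coordinates.

module Cover {A : Set} (full : List A) where

  -- At most e coordinates may be drawn from full instead of their own list.
  cover : ∀ {m} → ℕ → Vec (List A) m → List (Vec A m)
  cover e       []       = [] ∷ []
  cover zero    (c ∷ cs) = cartesianProductWith _∷_ c (cover zero cs)
  cover (suc e) (c ∷ cs) =
    cartesianProductWith _∷_ c (cover (suc e) cs) ++ cartesianProductWith _∷_ full (cover e cs)

  weight : ∀ {m} → Vec (List A) m → ℕ
  weight []       = 1
  weight (c ∷ cs) = length c * weight cs

  length-cover-zero : ∀ {m} (cs : Vec (List A) m) → length (cover 0 cs) ≡ weight cs
  length-cover-zero []       = refl
  length-cover-zero (c ∷ cs) = trans (length-cartesianProductWith _∷_ c (cover 0 cs))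
                                     (cong (length c *_) (length-cover-zero cs))

  length-cover-≤ : ∀ {m} e (cs : Vec (List A) m) → (∀ b → 1 ≤ length (lookup cs b)) →
                   length (cover e cs) ≤ weight cs * (1 + length full * m) ^ e
  length-cover-≤ {m} zero cs _ = ≤-reflexive (trans (length-cover-zero cs) (sym (*-identityʳ _)))
  length-cover-≤ (suc e) [] _ = begin
    1                                ≤⟨ m^n>0 (1 + length full * 0) (suc e) ⟩
    (1 + length full * 0) ^ suc e    ≡⟨ *-identityˡ _ ⟨
    1 * (1 + length full * 0) ^ suc e ∎
    where open ≤-Reasoning
  length-cover-≤ {suc m} (suc e) (c ∷ cs) ne = begin
    length (cartesianProductWith _∷_ c (cover (suc e) cs) ++
            cartesianProductWith _∷_ full (cover e cs))
      ≡⟨ length-++ (cartesianProductWith _∷_ c (cover (suc e) cs)) ⟩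
    length (cartesianProductWith _∷_ c (cover (suc e) cs)) +
    length (cartesianProductWith _∷_ full (cover e cs))
      ≡⟨ cong₂ _+_ (length-cartesianProductWith _∷_ c (cover (suc e) cs))
                   (length-cartesianProductWith _∷_ full (cover e cs)) ⟩
    l * length (cover (suc e) cs) + t * length (cover e cs)
      ≤⟨ +-mono-≤ (*-monoʳ-≤ l (length-cover-≤ (suc e) cs (λ b → ne (suc b))))
                  (*-monoʳ-≤ t (length-cover-≤ e cs (λ b → ne (suc b)))) ⟩
    l * (w * (a * a ^ e)) + t * (w * a ^ e)
      -- `1 ≤ l` gives `t ≤ l * t`, so that both summands share the factor `l * w`.
      ≤⟨ +-monoʳ-≤ _ (*-monoˡ-≤ (w * a ^ e) (m≤n*m t l ⦃ >-nonZero (ne zero) ⦄)) ⟩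
    l * (w * (a * a ^ e)) + l * t * (w * a ^ e)
      ≡⟨ solve 5 (λ l w t a p → l :* (w :* (a :* p)) :+ l :* t :* (w :* p) :=
                                l :* w :* ((a :+ t) :* p)) refl l w t a (a ^ e) ⟩
    l * w * ((a + t) * a ^ e)
      ≤⟨ *-monoʳ-≤ (l * w) (*-monoʳ-≤ (a + t) (^-monoˡ-≤ e (m≤m+n a t))) ⟩
    l * w * (a + t) ^ suc e
      ≡⟨ cong (λ z → l * w * z ^ suc e)
           (solve 2 (λ t m → con 1 :+ t :* m :+ t := con 1 :+ t :* (con 1 :+ m)) refl t m) ⟩
    l * w * (1 + t * suc m) ^ suc e
      ∎
    where
    open ≤-Reasoning
    open +-*-Solver
    l = length c
    t = length full
    a = 1 + t * m
    w = weight cs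

  unique-cover-zero : ∀ {m} (cs : Vec (List A) m) → (∀ b → Unique (lookup cs b)) →
                      Unique (cover 0 cs)
  unique-cover-zero []       _ = All.[] ∷ []
  unique-cover-zero (c ∷ cs) u = Unique.cartesianProductWith⁺ _∷_ ∷-injective
    (u zero) (unique-cover-zero cs (λ b → u (suc b)))

  ∈-cover-zero⁻ : ∀ {m} (cs : Vec (List A) m) {as} → as ∈ˡ cover 0 cs →
                  ∀ b → lookup as b ∈ˡ lookup cs b
  ∈-cover-zero⁻ (c ∷ cs) as∈ b with ∈-cartesianProductWith⁻ _∷_ c (cover 0 cs) as∈
  ∈-cover-zero⁻ (c ∷ cs) as∈ zero    | _ , _ , a∈ , _   , refl = a∈
  ∈-cover-zero⁻ (c ∷ cs) as∈ (suc b) | _ , _ , _  , as∈′ , refl = ∈-cover-zero⁻ cs as∈′ b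

  weight-++ : ∀ {m m′} (cs : Vec (List A) m) (ds : Vec (List A) m′) →
              weight (cs Vec.++ ds) ≡ weight cs * weight ds
  weight-++ []       ds = sym (*-identityˡ _)
  weight-++ (c ∷ cs) ds = trans (cong (length c *_) (weight-++ cs ds))
                                (sym (*-assoc (length c) (weight cs) (weight ds)))

  weight-replicate : ∀ m c → weight (replicate m c) ≡ length c ^ m
  weight-replicate zero    c = refl
  weight-replicate (suc m) c = cong (length c *_) (weight-replicate m c)

  -- A division-free form of exchanging one factor of the product. With a singleton for `d`, fixing
  -- a coordinate divides the weight by the length of its former list.
  weight-update : ∀ {m} (cs : Vec (List A) m) b d →
                  weight (cs [ b ]≔ d) * length (lookup cs b) ≡ length d * weight cs
  weight-update (c ∷ cs) zero    d = solve 3 (λ d w c → d :* w :* c := d :* (c :* w)) refl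
                                       (length d) (weight cs) (length c)
    where open +-*-Solver
  weight-update (c ∷ cs) (suc b) d = begin
    length c * weight (cs [ b ]≔ d) * length (lookup cs b)   ≡⟨ *-assoc (length c) _ _ ⟩
    length c * (weight (cs [ b ]≔ d) * length (lookup cs b)) ≡⟨ cong (length c *_) (weight-update cs b d) ⟩
    length c * (length d * weight cs)
      ≡⟨ solve 3 (λ c d w → c :* (d :* w) := d :* (c :* w)) refl (length c) (length d) (weight cs) ⟩
    length d * (length c * weight cs)                        ∎
    where
    open ≡-Reasoning
    open +-*-Solver

∣++∣ : ∀ {m n} (p : Subset m) (q : Subset n) → ∣ p Vec.++ q ∣ ≡ ∣ p ∣ + ∣ q ∣
∣++∣ []            q = refl
∣++∣ (inside  ∷ p) q = cong suc (∣++∣ p q)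
∣++∣ (outside ∷ p) q = ∣++∣ p q

∣concat∣-≤ : ∀ {m l L} (Bs : Vec (Subset l) m) → (∀ b → ∣ lookup Bs b ∣ ≤ L) → ∣ concat Bs ∣ ≤ m * L
∣concat∣-≤ []       _     = z≤n
∣concat∣-≤ (B ∷ Bs) bound rewrite ∣++∣ B (concat Bs) =
  +-mono-≤ (bound zero) (∣concat∣-≤ Bs (λ b → bound (suc b)))

∣concat∣-≡ : ∀ {m l L} (Bs : Vec (Subset l) m) → (∀ b → ∣ lookup Bs b ∣ ≡ L) → ∣ concat Bs ∣ ≡ m * L
∣concat∣-≡ []       _  = refl
∣concat∣-≡ (B ∷ Bs) eq rewrite ∣++∣ B (concat Bs) =
  cong₂ _+_ (eq zero) (∣concat∣-≡ Bs (λ b → eq (suc b)))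

-- Each coordinate smaller than the maximum L uses up one of the e exceptions.
∈-cover : ∀ {m l L} e (cs : Vec (List (Subset l)) m) (Bs : Vec (Subset l) m) →
          (∀ b → ∣ lookup Bs b ∣ ≤ L) →
          (∀ b → L ≤ ∣ lookup Bs b ∣ → lookup Bs b ∈ˡ lookup cs b) →
          m * L ≤ ∣ concat Bs ∣ + e →
          Bs ∈ˡ Cover.cover (subsets l) e cs
∈-cover e [] [] _ _ _ = here refl
∈-cover {suc m} {l} {L} e (c ∷ cs) (B ∷ Bs) ≤L ∈cs large with L ≤? ∣ B ∣
∈-cover {suc m} {l} {L} e (c ∷ cs) (B ∷ Bs) ≤L ∈cs large | yes L≤B = add e rest
  where
  open ≤-Reasoning
  rest : Bs ∈ˡ Cover.cover (subsets l) e cs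
  rest = ∈-cover e cs Bs (λ b → ≤L (suc b)) (λ b → ∈cs (suc b))
    (+-cancelˡ-≤ L _ _ (begin
      L + m * L                    ≤⟨ large ⟩
      ∣ B Vec.++ concat Bs ∣ + e   ≡⟨ cong (_+ e) (∣++∣ B (concat Bs)) ⟩
      ∣ B ∣ + ∣ concat Bs ∣ + e    ≡⟨ +-assoc ∣ B ∣ _ e ⟩
      ∣ B ∣ + (∣ concat Bs ∣ + e)  ≤⟨ +-monoˡ-≤ _ (≤L zero) ⟩
      L + (∣ concat Bs ∣ + e)      ∎))
  add : ∀ e → Bs ∈ˡ Cover.cover (subsets l) e cs → B ∷ Bs ∈ˡ Cover.cover (subsets l) e (c ∷ cs)
  add zero    p = ∈-cartesianProductWith⁺ _∷_ (∈cs zero L≤B) p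
  add (suc e) p = ∈-++⁺ˡ (∈-cartesianProductWith⁺ _∷_ (∈cs zero L≤B) p)
∈-cover {suc m} {l} {L} e (c ∷ cs) (B ∷ Bs) ≤L ∈cs large | no L≰B = spend e large′
  where
  open ≤-Reasoning
  large′ : suc (m * L) ≤ ∣ concat Bs ∣ + e
  large′ = +-cancelˡ-≤ ∣ B ∣ _ _ (begin
    ∣ B ∣ + suc (m * L)          ≡⟨ +-suc ∣ B ∣ (m * L) ⟩
    suc ∣ B ∣ + m * L            ≤⟨ +-monoˡ-≤ (m * L) (≰⇒> L≰B) ⟩
    L + m * L                    ≤⟨ large ⟩
    ∣ B Vec.++ concat Bs ∣ + e   ≡⟨ cong (_+ e) (∣++∣ B (concat Bs)) ⟩
    ∣ B ∣ + ∣ concat Bs ∣ + e    ≡⟨ +-assoc ∣ B ∣ _ e ⟩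
    ∣ B ∣ + (∣ concat Bs ∣ + e)  ∎)
  spend : ∀ e → suc (m * L) ≤ ∣ concat Bs ∣ + e → B ∷ Bs ∈ˡ Cover.cover (subsets l) e (c ∷ cs)
  spend zero    p = contradiction (≤-trans p (≤-reflexive (+-identityʳ _)))
                                  (<⇒≱ (s≤s (∣concat∣-≤ Bs (λ b → ≤L (suc b)))))
  spend (suc e) p = ∈-++⁺ʳ (cartesianProductWith _∷_ c _)
    (∈-cartesianProductWith⁺ _∷_ (∈-subsets B)
      (∈-cover e cs Bs (λ b → ≤L (suc b)) (λ b → ∈cs (suc b))
        (s≤s⁻¹ (≤-trans p (≤-reflexive (+-suc _ e))))))

-- Maximum independent sets of a path with an even number of vertices.

-- Stated through `toℕ`, so that adding or dropping a first vertex just shifts both sides of the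
-- equation by one.
PathIndependent : ∀ {m} → Subset m → Set
PathIndependent S = ∀ {p q} → toℕ q ≡ suc (toℕ p) → p ∈ S → q ∉ S

module _ {m} {S : Subset m} where

  pathIndependent-tail : ∀ {x} → PathIndependent (x ∷ S) → PathIndependent S
  pathIndependent-tail ind eq p∈S q∈S = ind (cong suc eq) (there p∈S) (there q∈S)

  pathIndependent-outside∷ : PathIndependent S → PathIndependent (outside ∷ S)
  pathIndependent-outside∷ ind eq (there p∈S) (there q∈S) = ind (suc-injective eq) p∈S q∈S

  pathIndependent-inside∷outside∷ : PathIndependent S → PathIndependent (inside ∷ outside ∷ S)
  pathIndependent-inside∷outside∷ ind eq here        (there (there q∈S)) with () ← eq
  pathIndependent-inside∷outside∷ ind eq (there p∈S) (there q∈S) =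
    pathIndependent-outside∷ ind (suc-injective eq) p∈S q∈S

  pathIndependent-inside∷ : (∀ {q} → toℕ q ≡ 0 → q ∉ S) → PathIndependent S →
                            PathIndependent (inside ∷ S)
  pathIndependent-inside∷ first∉ ind eq here        (there q∈S) = first∉ (suc-injective eq) q∈S
  pathIndependent-inside∷ first∉ ind eq (there p∈S) (there q∈S) = ind (suc-injective eq) p∈S q∈S

-- This is the only maximum independent set of the path that misses its first vertex.
evens : ∀ L → Subset (L * 2)
evens zero    = []
evens (suc L) = outside ∷ inside ∷ evens L

-- Along a path on L * 2 vertices, an independent set of size L has one vertex in each
-- of the L consecutive pairs, and all choices after the first even one are even too
-- (vertices being counted from 1).
maxPaths : ∀ L → List (Subset (L * 2))
maxPaths zero    = [] ∷ []
maxPaths (suc L) = evens (suc L) ∷ map (λ S → inside ∷ outside ∷ S) (maxPaths L)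

length-maxPaths : ∀ L → length (maxPaths L) ≡ suc L
length-maxPaths zero    = refl
length-maxPaths (suc L) = cong suc (trans (length-map _ (maxPaths L)) (length-maxPaths L))

unique-maxPaths : ∀ L → Unique (maxPaths L)
unique-maxPaths zero    = All.[] ∷ []
unique-maxPaths (suc L) =
  All.tabulate (λ S∈ eq → distinct (∈-map⁻ _ (subst (_∈ˡ _) (sym eq) S∈)))
  ∷ Unique.map⁺ (λ { refl → refl }) (unique-maxPaths L)
  where
  distinct : ¬ (∃[ S ] S ∈ˡ maxPaths L × evens (suc L) ≡ inside ∷ outside ∷ S)
  distinct (_ , _ , ())

evens∈maxPaths : ∀ L → evens L ∈ˡ maxPaths L
evens∈maxPaths zero    = here refl
evens∈maxPaths (suc L) = here refl

∣evens∣ : ∀ L → ∣ evens L ∣ ≡ L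
∣evens∣ zero    = refl
∣evens∣ (suc L) = cong suc (∣evens∣ L)

-- The leading `inside` makes the induction go through: behind the first two entries of
-- `inside ∷ evens (suc L)` stands `inside ∷ evens L` again.
pathIndependent-inside∷evens : ∀ L → PathIndependent (inside ∷ evens L)
pathIndependent-inside∷evens zero    {zero} {zero} ()
pathIndependent-inside∷evens (suc L) = pathIndependent-inside∷outside∷ (pathIndependent-inside∷evens L)

∣maxPath∣ : ∀ L {S} → S ∈ˡ maxPaths L → ∣ S ∣ ≡ L
∣maxPath∣ zero    (here refl) = refl
∣maxPath∣ (suc L) (here refl) = cong suc (∣evens∣ L)
∣maxPath∣ (suc L) (there S∈) with _ , S∈′ , refl ← ∈-map⁻ _ S∈ = cong suc (∣maxPath∣ L S∈′)

maxPath-pathIndependent : ∀ L {S} → S ∈ˡ maxPaths L → PathIndependent S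
maxPath-pathIndependent zero    (here refl) {()}
maxPath-pathIndependent (suc L) (here refl) =
  pathIndependent-outside∷ (pathIndependent-inside∷evens L)
maxPath-pathIndependent (suc L) (there S∈) with _ , S∈′ , refl ← ∈-map⁻ _ S∈ =
  pathIndependent-inside∷outside∷ (maxPath-pathIndependent L S∈′)

-- Supplies the set to be fixed on a branch in order to keep a given vertex of it out. In the pair
-- containing `p`, either pattern can occur in a maximum set, so the one missing `p` is taken.
maxPath-avoiding : ∀ L (p : Fin (L * 2)) → ∃[ S ] S ∈ˡ maxPaths L × p ∉ S
maxPath-avoiding (suc L) zero       = evens (suc L) , here refl , λ ()
maxPath-avoiding (suc L) (suc zero) =
  inside ∷ outside ∷ evens L , there (∈-map⁺ _ (evens∈maxPaths L)) , λ { (there ()) }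
maxPath-avoiding (suc L) (suc (suc p)) with maxPath-avoiding L p
... | S , S∈ , p∉S = inside ∷ outside ∷ S , there (∈-map⁺ _ S∈) , λ { (there (there p∈S)) → p∉S p∈S }

-- Each of the `L` consecutive pairs holds at most one element.
∣pathIndependent∣-≤ : ∀ L {S : Subset (L * 2)} → PathIndependent S → ∣ S ∣ ≤ L
∣pathIndependent∣-≤ zero    {[]}                    ind = z≤n
∣pathIndependent∣-≤ (suc L) {inside  ∷ inside  ∷ S} ind = contradiction (there here) (ind refl here)
∣pathIndependent∣-≤ (suc L) {inside  ∷ outside ∷ S} ind =
  s≤s (∣pathIndependent∣-≤ L (pathIndependent-tail (pathIndependent-tail ind)))
∣pathIndependent∣-≤ (suc L) {outside ∷ inside  ∷ S} ind =
  s≤s (∣pathIndependent∣-≤ L (pathIndependent-tail (pathIndependent-tail ind)))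
∣pathIndependent∣-≤ (suc L) {outside ∷ outside ∷ S} ind =
  m≤n⇒m≤1+n (∣pathIndependent∣-≤ L (pathIndependent-tail (pathIndependent-tail ind)))

-- The occupied vertex in front, a hub or the end of an earlier pair, excludes the first vertex of
-- the next pair. That pair must then supply its second vertex, which excludes the first vertex of
-- the pair after it, and so on.
large⇒evens : ∀ L {S : Subset (L * 2)} → PathIndependent (inside ∷ S) → L ≤ ∣ S ∣ → S ≡ evens L
large⇒evens zero    {[]}                    ind _ = refl
large⇒evens (suc L) {inside  ∷ y       ∷ S} ind _ = contradiction (there here) (ind refl here)
large⇒evens (suc L) {outside ∷ inside  ∷ S} ind (s≤s L≤) =
  cong (λ S → outside ∷ inside ∷ S)
    (large⇒evens L (pathIndependent-tail (pathIndependent-tail ind)) L≤)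
large⇒evens (suc L) {outside ∷ outside ∷ S} ind L≤ = contradiction L≤ (<⇒≱ (s≤s
  (∣pathIndependent∣-≤ L (pathIndependent-tail (pathIndependent-tail (pathIndependent-tail ind))))))

-- No pair can be empty. Pairs using their first vertex are peeled off; the first pair using its
-- second vertex forces all the rest by `large⇒evens`.
large⇒maxPath : ∀ L {S : Subset (L * 2)} → PathIndependent S → L ≤ ∣ S ∣ → S ∈ˡ maxPaths L
large⇒maxPath zero    {[]}                    ind _ = here refl
large⇒maxPath (suc L) {inside  ∷ inside  ∷ S} ind _ = contradiction (there here) (ind refl here)
large⇒maxPath (suc L) {inside  ∷ outside ∷ S} ind (s≤s L≤) =
  there (∈-map⁺ _ (large⇒maxPath L (pathIndependent-tail (pathIndependent-tail ind)) L≤))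
large⇒maxPath (suc L) {outside ∷ inside  ∷ S} ind (s≤s L≤) =
  here (cong (λ S → outside ∷ inside ∷ S) (large⇒evens L (pathIndependent-tail ind) L≤))
large⇒maxPath (suc L) {outside ∷ outside ∷ S} ind L≤ = contradiction L≤ (<⇒≱ (s≤s
  (∣pathIndependent∣-≤ L (pathIndependent-tail (pathIndependent-tail ind)))))

-- Counting the choices on the branches for a given set of hubs.

-- An occupied hub leaves only one maximum choice for each of its k branches.
branchOptions : ∀ L → Bool → List (Subset (L * 2))
branchOptions L inside  = evens L ∷ []
branchOptions L outside = maxPaths L

options : ∀ {n} k L → Subset n → Vec (List (Subset (L * 2))) (n * k)
options k L []      = []
options k L (x ∷ X) = replicate k (branchOptions L x) Vec.++ options k L X

lookup-options : ∀ {n} k L (X : Subset n) i j →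
                 lookup (options k L X) (combine i j) ≡ branchOptions L (lookup X i)
lookup-options k L (x ∷ X) zero    j =
  trans (lookup-++ˡ (replicate k (branchOptions L x)) _ j) (lookup-replicate j _)
lookup-options k L (x ∷ X) (suc i) j =
  trans (lookup-++ʳ (replicate k (branchOptions L x)) _ (combine i j)) (lookup-options k L X i j)

module _ (k L : ℕ) where
  open Cover (subsets (L * 2))

  weight-options : ∀ {n} x (X : Subset n) →
    weight (options k L (x ∷ X)) ≡ length (branchOptions L x) ^ k * weight (options k L X)
  weight-options x X = trans (weight-++ (replicate k (branchOptions L x)) (options k L X))
    (cong (_* weight (options k L X)) (weight-replicate k (branchOptions L x)))

  length-branchOptions-≤ : ∀ x → length (branchOptions L x) ≤ suc L
  length-branchOptions-≤ inside  = s≤s z≤n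
  length-branchOptions-≤ outside = ≤-reflexive (length-maxPaths L)

  weight-options-≤ : ∀ {n} (X : Subset n) → weight (options k L X) ≤ suc L ^ (n * k)
  weight-options-≤ {zero}  []      = ≤-refl
  weight-options-≤ {suc n} (x ∷ X) = begin
    weight (options k L (x ∷ X))                             ≡⟨ weight-options x X ⟩
    length (branchOptions L x) ^ k * weight (options k L X)
      ≤⟨ *-mono-≤ (^-monoˡ-≤ k (length-branchOptions-≤ x)) (weight-options-≤ X) ⟩
    suc L ^ k * suc L ^ (n * k)                              ≡⟨ ^-distribˡ-+-* (suc L) k (n * k) ⟨
    suc L ^ (suc n * k)                                      ∎
    where open ≤-Reasoning

  -- The first occupied hub contributes `1 ^ k` where a free hub contributes `suc L ^ k`. This one
  -- gain is all that is claimed; later hubs are bounded as if they were free.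
  weight-options-nonempty-≤ : ∀ {n} (X : Subset n) → 1 ≤ ∣ X ∣ →
                              weight (options k L X) * suc L ^ k ≤ suc L ^ (n * k)
  weight-options-nonempty-≤ {suc n} (inside ∷ X) _ = begin
    weight (options k L (inside ∷ X)) * suc L ^ k    ≡⟨ cong (_* suc L ^ k) (weight-options inside X) ⟩
    1 ^ k * weight (options k L X) * suc L ^ k
      ≡⟨ cong (λ z → z * weight (options k L X) * suc L ^ k) (^-zeroˡ k) ⟩
    1 * weight (options k L X) * suc L ^ k           ≡⟨ cong (_* suc L ^ k) (*-identityˡ (weight (options k L X))) ⟩
    weight (options k L X) * suc L ^ k               ≤⟨ *-monoˡ-≤ (suc L ^ k) (weight-options-≤ X) ⟩
    suc L ^ (n * k) * suc L ^ k                      ≡⟨ *-comm (suc L ^ (n * k)) _ ⟩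
    suc L ^ k * suc L ^ (n * k)                      ≡⟨ ^-distribˡ-+-* (suc L) k (n * k) ⟨
    suc L ^ (suc n * k)                              ∎
    where open ≤-Reasoning
  weight-options-nonempty-≤ {suc n} (outside ∷ X) 1≤X = begin
    weight (options k L (outside ∷ X)) * suc L ^ k   ≡⟨ cong (_* suc L ^ k) (weight-options outside X) ⟩
    length (maxPaths L) ^ k * weight (options k L X) * suc L ^ k
      ≡⟨ *-assoc (length (maxPaths L) ^ k) _ _ ⟩
    length (maxPaths L) ^ k * (weight (options k L X) * suc L ^ k)
      ≤⟨ *-mono-≤ (≤-reflexive (cong (_^ k) (length-maxPaths L))) (weight-options-nonempty-≤ X 1≤X) ⟩
    suc L ^ k * suc L ^ (n * k)                      ≡⟨ ^-distribˡ-+-* (suc L) k (n * k) ⟨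
    suc L ^ (suc n * k)                              ∎
    where open ≤-Reasoning

-- Trees given by a parent function.

module ParentTree {m : ℕ} (parent : Fin m → Maybe (Fin m)) (depth : Fin m → ℕ) (root : Fin m)
  (depth-root   : depth root ≡ 0)
  (parent-depth : ∀ {u w} → parent u ≡ just w → depth u ≡ suc (depth w))
  (orphan       : ∀ {u} → parent u ≡ nothing → u ≡ root)
  where

  tree : Graph
  tree = record
    { order  = m
    ; Adj    = λ u w → parent u ≡ just w ⊎ parent w ≡ just u
    ; adj?   = λ u w → ≡-decᵐ Fin._≟_ (parent u) (just w) ⊎-dec ≡-decᵐ Fin._≟_ (parent w) (just u)
    ; sym    = swap
    ; irrefl = λ { (inj₁ p) → contradiction (parent-depth p) (<⇒≢ ≤-refl)
                 ; (inj₂ p) → contradiction (parent-depth p) (<⇒≢ ≤-refl) }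
    }
  open Graph tree using (Adj)

  parent-depth-< : ∀ {u w} → parent u ≡ just w → depth w < depth u
  parent-depth-< p = ≤-reflexive (sym (parent-depth p))

  parent-unique : ∀ {u v w} → parent u ≡ just v → parent u ≡ just w → v ≡ w
  parent-unique p q = just-injective (trans (sym p) q)

  snoc : ∀ {u v w k} → Walk tree u v k → Adj v w → Walk tree u w (suc k)
  snoc []      e = e ∷ []
  snoc (f ∷ p) e = f ∷ snoc p e

  reverse : ∀ {u v k} → Walk tree u v k → Walk tree v u k
  reverse []      = []
  reverse (e ∷ p) = snoc (reverse p) (swap e)

  _++ʷ_ : ∀ {u v w j k} → Walk tree u v j → Walk tree v w k → Walk tree u w (j + k)
  []      ++ʷ q = q
  (e ∷ p) ++ʷ q = e ∷ (p ++ʷ q)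

  -- The depth is the recursion argument `j`, since it is what decreases on passing to the parent;
  -- the walk is extended at its far end.
  descend : ∀ {j} u → depth u ≡ j → Walk tree root u j
  descend u eq with parent u in par
  descend {zero}  u eq | just w  = contradiction (trans (sym eq) (parent-depth par)) λ ()
  descend {suc j} u eq | just w  =
    snoc (descend w (suc-injective (trans (sym (parent-depth par)) eq))) (inj₂ par)
  descend {j}     u eq | nothing with refl ← orphan par with refl ← trans (sym depth-root) eq = []

  depth-walk-≤ : ∀ {u w j} → Walk tree u w j → depth w ≤ depth u + j
  depth-walk-≤ {u}     []                            = m≤m+n (depth u) 0
  depth-walk-≤ {u} {w} (_∷_ {v = v} {k = k} e p) = begin
    depth w           ≤⟨ depth-walk-≤ p ⟩
    depth v + k       ≤⟨ +-monoˡ-≤ k (edge e) ⟩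
    suc (depth u) + k ≡⟨ +-suc (depth u) k ⟨
    depth u + suc k   ∎
    where
    open ≤-Reasoning
    edge : Adj u v → depth v ≤ suc (depth u)
    edge (inj₁ q) = m≤n⇒m≤1+n (<⇒≤ (parent-depth-< q))
    edge (inj₂ q) = ≤-reflexive (parent-depth q)

  -- The walk along parents has length `depth u`, and no walk is shorter because an edge raises the
  -- depth by at most one, starting from zero.
  distance-root : ∀ u → IsDistance tree root u (depth u)
  distance-root u = descend u refl , λ {j} p →
    subst (λ z → depth u ≤ z + j) depth-root (depth-walk-≤ p)

  -- A walk that does not backtrack never goes up again after a step down.
  down⇒down : ∀ {a b x} ws → Linked Adj (a ∷ b ∷ ws ++ x ∷ []) → Unique (a ∷ b ∷ ws) →
              All (x ≢_) (a ∷ b ∷ ws) → parent b ≡ just a → depth b < depth x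
  down⇒down []       (_ ∷ inj₁ q ∷ _) _ (x≢a ∷ _) p = contradiction (parent-unique q p) x≢a
  down⇒down []       (_ ∷ inj₂ q ∷ _) _ _         p = parent-depth-< q
  down⇒down (c ∷ ws) (_ ∷ inj₁ q ∷ _) ((_ ∷ a≢c ∷ _) ∷ _) _ p =
    contradiction (parent-unique p q) a≢c
  down⇒down (c ∷ ws) (_ ∷ l@(inj₂ q ∷ _)) (_ ∷ u) (_ ∷ x≢) p =
    <-trans (parent-depth-< q) (down⇒down ws l u x≢ q)

  -- If the last step goes down, it starts at the parent of `x`. If it goes up, an earlier step down
  -- would contradict `down⇒down`, so every step goes up and the depth falls all the way.
  up-or-last-down : ∀ {a x} ws → Linked Adj (a ∷ ws ++ x ∷ []) → Unique (a ∷ ws) →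
                    All (x ≢_) (a ∷ ws) →
                    (∃[ l ] l ∈ˡ a ∷ ws × parent x ≡ just l) ⊎ depth x < depth a
  up-or-last-down [] (inj₁ q ∷ _) _ _ = inj₂ (parent-depth-< q)
  up-or-last-down [] (inj₂ q ∷ _) _ _ = inj₁ (_ , here refl , q)
  up-or-last-down (c ∷ ws) l@(e ∷ l′) u@(_ ∷ u′) x≢@(_ ∷ x≢′) with up-or-last-down ws l′ u′ x≢′ | e
  ... | inj₁ (y , y∈ , q) | _      = inj₁ (y , there y∈ , q)
  ... | inj₂ x<c          | inj₁ q = inj₂ (<-trans x<c (parent-depth-< q))
  ... | inj₂ x<c          | inj₂ q = contradiction x<c (<-asym (down⇒down ws l u x≢ q))

  -- The cases are the directions of the first two steps, from `x` to `y` and on to `z`. Down then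
  -- up gives `y` two parents, forcing `x` and `z` to agree; twice down, `down⇒down` makes `x`
  -- deeper than `z`, hence deeper than itself.
  acyclic : ¬ Cycle tree
  acyclic record { ws = ws ; distinct = x≢@(_ ∷ x≢z ∷ _) ∷ u ; closed = inj₂ p ∷ inj₁ q ∷ _ } =
    contradiction (parent-unique p q) x≢z
  acyclic record { ws = ws ; distinct = x≢ ∷ u ; closed = inj₂ p ∷ l@(inj₂ q ∷ _) } =
    <-asym (down⇒down ws l u x≢ q) (<-trans (parent-depth-< p) (parent-depth-< q))
  -- Now `y` is the parent of `x`. Returning to `x` by a step down would put that parent on the
  -- cycle a second time; otherwise `x` is less deep than `z`, while one or two steps away from it
  -- `z` is at most as deep as `x`.
  acyclic record { ws = ws ; distinct = (_ ∷ x≢) ∷ y≢ ∷ u ; closed = inj₁ p ∷ e ∷ l }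
    with up-or-last-down ws l u x≢ | e
  ... | inj₁ (y , y∈ , q) | _      = All.lookup y≢ y∈ (parent-unique p q)
  ... | inj₂ x<z          | inj₁ q = <-asym x<z (<-trans (parent-depth-< q) (parent-depth-< p))
  ... | inj₂ x<z          | inj₂ q = <⇒≢ x<z (trans (parent-depth p) (sym (parent-depth q)))

  isTree : IsTree tree
  isTree = record
    { nonEmpty  = Fin.nonZeroIndex root
    ; connected = λ u w → _ , reverse (descend u refl) ++ʷ descend w refl
    ; acyclic   = acyclic
    }

-- Neighbourhoods and degrees.

∣p∣≡1⇒unique : ∀ {m} {p : Subset m} {x y} → ∣ p ∣ ≡ 1 → x ∈ p → y ∈ p → x ≡ y
∣p∣≡1⇒unique {p = p} {x} {y} eq x∈p y∈p with y Fin.≟ x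
... | yes refl = refl
-- Removing `x` and then `y` would lower the cardinality twice, starting from 1.
... | no  y≢x  = contradiction (x∈p⇒∣p-x∣<∣p∣ x∈p)
  (≤⇒≯ (≤-trans (≤-reflexive eq) (≤-<-trans z≤n (x∈p⇒∣p-x∣<∣p∣ (x∈p∧x≢y⇒x∈p-y y∈p y≢x)))))

module _ (G : Graph) where
  open Graph G using (Adj; adj?)

  ∈-neighbourhood⁺ : ∀ {u w} → Adj u w → w ∈ neighbourhood G u
  ∈-neighbourhood⁺ {u} {w} e = lookup⇒[]= w _
    (trans (lookup∘tabulate (λ w → does (adj? u w)) w) (dec-true (adj? u w) e))

  ∈-neighbourhood⁻ : ∀ {u w} → w ∈ neighbourhood G u → Adj u w
  ∈-neighbourhood⁻ {u} {w} w∈ with adj? u w | trans (sym (lookup∘tabulate (λ w → does (adj? u w)) w)) ([]=⇒lookup w∈)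
  ... | yes e | _ = e

-- The spider, its vertices and its leaves.

-- The root has n hubs below it and every hub has k branches, paths on l vertices
-- numbered away from the root; branch b hangs from hub quotient k b.
module Spider (n k l : ℕ) where

  order : ℕ
  order = suc (n + n * k * l)

  -- Case analysis follows the shape of the spider on this type, which `encode` and `decode`
  -- identify with `Fin order`. The numbering puts the root first, then the hubs, then the branches
  -- one after another.
  data Location : Set where
    root : Location
    hub  : Fin n → Location
    node : Fin (n * k) → Fin l → Location

  encode : Location → Fin order
  encode root       = zero
  encode (hub i)    = suc (i ↑ˡ (n * k * l))
  encode (node b p) = suc (n ↑ʳ combine b p)

  decodeBelow : Fin n ⊎ Fin (n * k * l) → Location
  decodeBelow (inj₁ i) = hub i
  decodeBelow (inj₂ c) = uncurry node (remQuot l c)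

  decode : Fin order → Location
  decode zero    = root
  decode (suc u) = decodeBelow (splitAt n u)

  decode-encode : ∀ a → decode (encode a) ≡ a
  decode-encode root       = refl
  decode-encode (hub i)    = cong decodeBelow (Fin.splitAt-↑ˡ n i _)
  decode-encode (node b p) = trans (cong decodeBelow (Fin.splitAt-↑ʳ n _ (combine b p)))
                                   (cong (uncurry node) (Fin.remQuot-combine b p))

  encode-decode : ∀ u → encode (decode u) ≡ u
  encode-decode zero    = refl
  encode-decode (suc u) with splitAt n u in eq
  ... | inj₁ i = cong suc (Fin.splitAt⁻¹-↑ˡ eq)
  ... | inj₂ c = cong suc (trans (cong (n ↑ʳ_) (Fin.combine-remQuot {n * k} l c)) (Fin.splitAt⁻¹-↑ʳ eq))

  encode-injective : ∀ {a c} → encode a ≡ encode c → a ≡ c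
  encode-injective {a} {c} eq =
    trans (sym (decode-encode a)) (trans (cong decode eq) (decode-encode c))

  above : Location → Maybe Location
  above root             = nothing
  above (hub i)          = just root
  above (node b zero)    = just (hub (quotient k b))
  above (node b (suc p)) = just (node b (inject₁ p))

  level : Location → ℕ
  level root       = 0
  level (hub i)    = 1
  level (node b p) = 2 + toℕ p

  above-level : ∀ {a c} → above a ≡ just c → level a ≡ suc (level c)
  above-level {hub i}          refl = refl
  above-level {node b zero}    refl = refl
  above-level {node b (suc p)} refl = cong (3 +_) (sym (Fin.toℕ-inject₁ p))

  above-next : ∀ {b p q} → toℕ q ≡ suc (toℕ p) → above (node b q) ≡ just (node b p)
  above-next {q = suc q} eq =
    cong (λ p → just (node _ p)) (Fin.toℕ-injective (trans (Fin.toℕ-inject₁ q) (suc-injective eq)))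

  above-node : ∀ b p → ∃[ a ] above (node b p) ≡ just a
  above-node b zero    = _ , refl
  above-node b (suc p) = _ , refl

  parent : Fin order → Maybe (Fin order)
  parent u = Maybe.map encode (above (decode u))

  parent⁻ : ∀ {u w} → parent u ≡ just w → above (decode u) ≡ just (decode w)
  parent⁻ {u} eq with above (decode u)
  parent⁻ refl | just c = cong just (sym (decode-encode c))

  parent⁺ : ∀ {a c} → above a ≡ just c → parent (encode a) ≡ just (encode c)
  parent⁺ {a} eq = cong (Maybe.map encode) (trans (cong above (decode-encode a)) eq)

  orphan : ∀ {u} → parent u ≡ nothing → u ≡ zero
  orphan {u} eq with decode u in eqᵤ
  ... | root = trans (sym (encode-decode u)) (cong encode eqᵤ)
  orphan () | hub _
  orphan () | node _ zero
  orphan () | node _ (suc _)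

  open ParentTree parent (λ u → level (decode u)) zero refl
    (λ {u} {w} eq → above-level (parent⁻ {u} {w} eq)) orphan public
  open Graph tree using (Adj)

  adj⁺ : ∀ {a c} → above a ≡ just c → Adj (encode a) (encode c)
  adj⁺ eq = inj₁ (parent⁺ eq)

  adj⁻ : ∀ {a c} → Adj (encode a) (encode c) → above a ≡ just c ⊎ above c ≡ just a
  adj⁻ {a} {c} e = Sum.map (parent⁻′ a c) (parent⁻′ c a) e
    where
    parent⁻′ : ∀ a c → parent (encode a) ≡ just (encode c) → above a ≡ just c
    parent⁻′ a c eq = subst₂ (λ a c → above a ≡ just c) (decode-encode a) (decode-encode c)
                             (parent⁻ {encode a} {encode c} eq)

  -- The three blocks follow the numbering of `encode`: root, hubs, branches.
  assemble : Bool → Subset n → Vec (Subset l) (n * k) → Subset order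
  assemble s X Bs = s ∷ (X Vec.++ concat Bs)

  disassemble : ∀ S → ∃[ s ] ∃[ X ] ∃[ Bs ] S ≡ assemble s X Bs
  disassemble (s ∷ S) with Vec.splitAt n S
  ... | X , R , refl with Vec.group (n * k) l R
  ... | Bs , refl = s , X , Bs , refl

  ∣assemble-outside∣ : ∀ X Bs → ∣ assemble outside X Bs ∣ ≡ ∣ X ∣ + ∣ concat Bs ∣
  ∣assemble-outside∣ X Bs = ∣++∣ X (concat Bs)

  ∣assemble-inside∣ : ∀ Bs → ∣ assemble inside ⊥ Bs ∣ ≡ suc ∣ concat Bs ∣
  ∣assemble-inside∣ Bs =
    cong suc (trans (∣++∣ {n} ⊥ (concat Bs)) (cong (_+ ∣ concat Bs ∣) (∣⊥∣≡0 n)))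

  assemble-injective : ∀ {s X Bs Bs′} → assemble s X Bs ≡ assemble s X Bs′ → Bs ≡ Bs′
  assemble-injective {X = X} {Bs} {Bs′} eq =
    concat-injective Bs Bs′ (Vec.++-injectiveʳ X X (Vec.∷-injectiveʳ eq))
    where
    concat-injective : ∀ {m} (Bs Bs′ : Vec (Subset l) m) → concat Bs ≡ concat Bs′ → Bs ≡ Bs′
    concat-injective []       []         _  = refl
    concat-injective (B ∷ Bs) (B′ ∷ Bs′) eq with Vec.++-injective B B′ eq
    ... | B≡B′ , eq′ = cong₂ _∷_ B≡B′ (concat-injective Bs Bs′ eq′)

  module _ {s : Bool} {X : Subset n} {Bs : Vec (Subset l) (n * k)} where

    lookup-hub : ∀ i → lookup (assemble s X Bs) (encode (hub i)) ≡ lookup X i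
    lookup-hub i = lookup-++ˡ X (concat Bs) i

    lookup-node : ∀ b p → lookup (assemble s X Bs) (encode (node b p)) ≡ lookup (lookup Bs b) p
    lookup-node b p = trans (lookup-++ʳ X (concat Bs) (combine b p)) (lookup-concat Bs b p)

    hub∈⁺ : ∀ {i} → i ∈ X → encode (hub i) ∈ assemble s X Bs
    hub∈⁺ {i} i∈X = lookup⇒[]= _ _ (trans (lookup-hub i) ([]=⇒lookup i∈X))

    hub∈⁻ : ∀ {i} → encode (hub i) ∈ assemble s X Bs → i ∈ X
    hub∈⁻ {i} i∈ = lookup⇒[]= i X (trans (sym (lookup-hub i)) ([]=⇒lookup i∈))

    node∈⁺ : ∀ {b p} → p ∈ lookup Bs b → encode (node b p) ∈ assemble s X Bs
    node∈⁺ {b} {p} p∈B = lookup⇒[]= _ _ (trans (lookup-node b p) ([]=⇒lookup p∈B))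

    node∈⁻ : ∀ {b p} → encode (node b p) ∈ assemble s X Bs → p ∈ lookup Bs b
    node∈⁻ {b} {p} p∈ = lookup⇒[]= p _ (trans (sym (lookup-node b p)) ([]=⇒lookup p∈))

    independent⇒pathIndependent : Independent tree (assemble s X Bs) →
                                  ∀ b → PathIndependent (lookup Bs b)
    independent⇒pathIndependent ind b eq p∈ q∈ =
      ind _ _ (node∈⁺ q∈) (node∈⁺ p∈) (adj⁺ (above-next eq))

    -- An occupied hub thus acts as an occupied vertex placed in front of each of its branches, as
    -- `large⇒evens` requires.
    independent⇒first∉ : Independent tree (assemble s X Bs) → ∀ {i} j {q} → i ∈ X →
                         toℕ q ≡ 0 → q ∉ lookup Bs (combine i j)
    independent⇒first∉ ind {i} j {zero} i∈X _ q∈ = ind _ _ (node∈⁺ q∈) (hub∈⁺ i∈X)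
      (adj⁺ {node (combine i j) zero} (cong (λ i → just (hub i)) (cong proj₁ (Fin.remQuot-combine i j))))

  -- Every edge either meets a hub, and no hub is occupied, or joins consecutive vertices of one
  -- branch.
  assemble-independent : ∀ {Bs} → (∀ b → PathIndependent (lookup Bs b)) →
                         Independent tree (assemble inside ⊥ Bs)
  assemble-independent {Bs} ind u w u∈ w∈ e =
    Sum.[ clash u∈′ w∈′ , clash w∈′ u∈′ ]
      (adj⁻ (subst₂ Adj (sym (encode-decode u)) (sym (encode-decode w)) e))
    where
    S = assemble inside ⊥ Bs
    u∈′ = subst (_∈ S) (sym (encode-decode u)) u∈
    w∈′ = subst (_∈ S) (sym (encode-decode w)) w∈
    clash : ∀ {a c} → encode a ∈ S → encode c ∈ S → ¬ (above a ≡ just c)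
    clash {hub i}          a∈ _  refl = ∉⊥ (hub∈⁻ {inside} {⊥} {Bs} a∈)
    clash {node b zero}    _  c∈ refl = ∉⊥ (hub∈⁻ {inside} {⊥} {Bs} c∈)
    clash {node b (suc p)} a∈ c∈ refl =
      ind b (cong suc (sym (Fin.toℕ-inject₁ p)))
          (node∈⁻ {inside} {⊥} {Bs} c∈) (node∈⁻ {inside} {⊥} {Bs} a∈)

  -- The neighbourhood is identified with the block of hubs in the numbering, whose cardinality can
  -- be read off.
  degree-root : degree tree zero ≡ n
  degree-root = trans (cong ∣_∣ neighbours) (trans (∣++∣ {n} ⊤ ⊥)
    (trans (cong₂ _+_ (∣⊤∣≡n n) (∣⊥∣≡0 (n * k * l))) (+-identityʳ n)))
    where
    hubs : Subset order
    hubs = outside ∷ (⊤ {n} Vec.++ ⊥ {n * k * l})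
    hub∈hubs : ∀ i → encode (hub i) ∈ hubs
    hub∈hubs i = there (lookup⇒[]= _ _ (trans (lookup-++ˡ {n = n * k * l} ⊤ ⊥ i) (lookup-replicate i inside)))
    node∉hubs : ∀ b p → encode (node b p) ∉ hubs
    node∉hubs b p (there p∈) with () ← trans (sym (trans (lookup-++ʳ (⊤ {n}) ⊥ (combine b p))
      (lookup-replicate (combine b p) outside))) ([]=⇒lookup p∈)
    to : ∀ a → encode a ∈ neighbourhood tree zero → encode a ∈ hubs
    to root             a∈ = contradiction (∈-neighbourhood⁻ tree a∈) (Graph.irrefl tree)
    to (hub i)          _  = hub∈hubs i
    to (node b p) a∈ with adj⁻ {root} {node b p} (∈-neighbourhood⁻ tree a∈)
    to (node b zero)    _ | inj₂ ()
    to (node b (suc p)) _ | inj₂ ()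
    from : ∀ a → encode a ∈ hubs → encode a ∈ neighbourhood tree zero
    from root       ()
    from (hub i)    _  = ∈-neighbourhood⁺ tree (inj₂ (parent⁺ {hub i} refl))
    from (node b p) a∈ = contradiction a∈ (node∉hubs b p)
    neighbours : neighbourhood tree zero ≡ hubs
    neighbours = ⊆-antisym
      (λ {u} u∈ → subst (_∈ hubs) (encode-decode u)
        (to (decode u) (subst (_∈ neighbourhood tree zero) (sym (encode-decode u)) u∈)))
      (λ {u} u∈ → subst (_∈ neighbourhood tree zero) (encode-decode u)
        (from (decode u) (subst (_∈ hubs) (sym (encode-decode u)) u∈)))

  -- The neighbours `a` and `e` have levels differing by two, so they are distinct.
  parent-and-child⇒¬leaf : ∀ {a c e} → above c ≡ just a → above e ≡ just c → ¬ IsLeaf tree (encode c)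
  parent-and-child⇒¬leaf {a} {c} {e} up down leaf =
    <⇒≢ (m≤n⇒m≤1+n ≤-refl) (trans (cong level a≡e) (trans (above-level down) (cong suc (above-level up))))
    where
    a≡e : a ≡ e
    a≡e = encode-injective (∣p∣≡1⇒unique leaf (∈-neighbourhood⁺ tree (adj⁺ up))
                                              (∈-neighbourhood⁺ tree (swap (adj⁺ down))))

module _ {n k l : ℕ} where
  open Spider n (suc k) (suc l)

  -- The root has `n` neighbours, at least two, while hubs and inner branch vertices have both a
  -- parent and a child. What remains is the last vertex of a branch. The parameters `suc k` and
  -- `suc l` provide a child for every hub and a last vertex for every branch.
  leaf-depth : 2 ≤ n → ∀ w → IsLeaf tree w → 2 + l ≤ level (decode w)
  leaf-depth 2≤n w leaf = deep (decode w) (subst (IsLeaf tree) (sym (encode-decode w)) leaf)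
    where
    deep : ∀ a → IsLeaf tree (encode a) → 2 + l ≤ level a
    deep root       leaf = contradiction (trans (sym degree-root) leaf) (>⇒≢ 2≤n)
    deep (hub i)    leaf = contradiction leaf (parent-and-child⇒¬leaf {c = hub i} {node (combine i zero) zero}
      refl (cong (λ i → just (hub i)) (cong proj₁ (Fin.remQuot-combine i (zero {k})))))
    deep (node b p) leaf with view p
    ... | ‵fromℕ     = s≤s (s≤s (≤-reflexive (sym (Fin.toℕ-fromℕ l))))
    ... | ‵inject₁ q = contradiction leaf
      (parent-and-child⇒¬leaf {e = node b (suc q)} (proj₂ (above-node b (inject₁ q))) refl)

-- Comparing the stars of the spider.

module SpiderStars (n k L : ℕ) where
  open Spider n k (L * 2) public
  open Cover (subsets (L * 2))

  r : ℕ
  r = suc (n * k * L)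

  N : ℕ
  N = suc L

  -- A covering list for the sets without the root whose hubs form `X`; it may contain repetitions
  -- and unsuitable sets. An empty `X` needs no candidates, since the branches alone hold at most
  -- `r - 1` elements.
  avoidersAt : ∀ (X : Subset n) → List (Subset order)
  avoidersAt X with 1 ≤? ∣ X ∣
  ... | yes _ = map (assemble outside X) (cover n (options k L X))
  ... | no  _ = []

  avoiders : List (Subset order)
  avoiders = concatMap avoidersAt (subsets n)

  ∈-avoiders : ∀ {S} → Independent tree S → ∣ S ∣ ≡ r → zero ∉ S → S ∈ˡ avoiders
  ∈-avoiders {S} ind size 0∉S with disassemble S
  ... | inside  , X , Bs , refl = contradiction here 0∉S
  ... | outside , X , Bs , refl =
    ∈-concatMap⁺ avoidersAt (Any.map (λ { refl → ∈-avoidersAt }) (∈-subsets X))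
    where
    open ≤-Reasoning
    path : ∀ b → PathIndependent (lookup Bs b)
    path = independent⇒pathIndependent {outside} {X} {Bs} ind

    small : ∀ b → ∣ lookup Bs b ∣ ≤ L
    small b = ∣pathIndependent∣-≤ L (path b)

    size′ : ∣ X ∣ + ∣ concat Bs ∣ ≡ r
    size′ = trans (sym (∣assemble-outside∣ X Bs)) size

    nonempty : 1 ≤ ∣ X ∣
    nonempty = +-cancelʳ-≤ (n * k * L) 1 ∣ X ∣ (begin
      suc (n * k * L)       ≡⟨ size′ ⟨
      ∣ X ∣ + ∣ concat Bs ∣ ≤⟨ +-monoʳ-≤ ∣ X ∣ (∣concat∣-≤ Bs small) ⟩
      ∣ X ∣ + n * k * L     ∎)

    -- At most `n` elements are hubs, so the branches together fall short of their maximum by at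
    -- most `n`: this is the number of exceptions granted to `cover`.
    large : n * k * L ≤ ∣ concat Bs ∣ + n
    large = begin
      n * k * L             ≤⟨ n≤1+n _ ⟩
      suc (n * k * L)       ≡⟨ size′ ⟨
      ∣ X ∣ + ∣ concat Bs ∣ ≤⟨ +-monoˡ-≤ _ (∣p∣≤n X) ⟩
      n + ∣ concat Bs ∣     ≡⟨ +-comm n _ ⟩
      ∣ concat Bs ∣ + n     ∎

    option : ∀ b → L ≤ ∣ lookup Bs b ∣ → lookup Bs b ∈ˡ lookup (options k L X) b
    option b L≤ with Fin.combine-surjective {n} {k} b
    ... | i , j , refl rewrite lookup-options k L X i j with lookup X i in eq
    ... | inside  = here (large⇒evens L (pathIndependent-inside∷
      (independent⇒first∉ {outside} {X} {Bs} ind j (Vec.lookup⇒[]= i X eq)) (path (combine i j))) L≤)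
    ... | outside = large⇒maxPath L (path (combine i j)) L≤

    ∈-avoidersAt : assemble outside X Bs ∈ˡ avoidersAt X
    ∈-avoidersAt with 1 ≤? ∣ X ∣
    ... | yes _   = ∈-map⁺ (assemble outside X) (∈-cover n (options k L X) Bs small option large)
    ... | no  1≰X = contradiction nonempty 1≰X

  -- The price of `n` exceptional branches in `length-cover-≤`; for fixed `n` and `L` it is
  -- polynomial in `k`.
  exceptions : ℕ
  exceptions = (1 + length (subsets (L * 2)) * (n * k)) ^ n

  length-avoidersAt-≤ : ∀ X → length (avoidersAt X) * N ^ k ≤ N ^ (n * k) * exceptions
  length-avoidersAt-≤ X with 1 ≤? ∣ X ∣
  ... | no  _   = z≤n
  ... | yes 1≤X = begin
    length (map (assemble outside X) (cover n cs)) * N ^ k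
      ≡⟨ cong (_* N ^ k) (length-map _ (cover n cs)) ⟩
    length (cover n cs) * N ^ k
      ≤⟨ *-monoˡ-≤ (N ^ k) (length-cover-≤ n cs nonempty) ⟩
    weight cs * exceptions * N ^ k
      ≡⟨ solve 3 (λ w e p → w :* e :* p := w :* p :* e) refl (weight cs) exceptions (N ^ k) ⟩
    weight cs * N ^ k * exceptions
      ≤⟨ *-monoˡ-≤ exceptions (weight-options-nonempty-≤ k L X 1≤X) ⟩
    N ^ (n * k) * exceptions
      ∎
    where
    open ≤-Reasoning
    open +-*-Solver
    cs = options k L X
    branchOptions-nonempty : ∀ x → 1 ≤ length (branchOptions L x)
    branchOptions-nonempty inside  = s≤s z≤n
    branchOptions-nonempty outside = ≤-trans (s≤s z≤n) (≤-reflexive (sym (length-maxPaths L)))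
    nonempty : ∀ b → 1 ≤ length (lookup cs b)
    nonempty b with Fin.combine-surjective {n} {k} b
    ... | i , j , refl rewrite lookup-options k L X i j = branchOptions-nonempty (lookup X i)

  length-avoiders-≤ : length avoiders * N ^ k ≤ 2 ^ n * (N ^ (n * k) * exceptions)
  length-avoiders-≤ = begin
    length avoiders * N ^ k
      ≤⟨ length-concatMap-≤ avoidersAt (N ^ k) (subsets n) length-avoidersAt-≤ ⟩
    length (subsets n) * (N ^ (n * k) * exceptions)
      ≡⟨ cong (_* (N ^ (n * k) * exceptions)) (length-subsets n) ⟩
    2 ^ n * (N ^ (n * k) * exceptions)
      ∎
    where open ≤-Reasoning

  -- Branch `b` is fixed to `B` and all others range over their maximum sets. If `B` misses a vertex
  -- of branch `b`, so do all the resulting members of the root's star.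
  module Pinned (b : Fin (n * k)) {B : Subset (L * 2)} (B∈ : B ∈ˡ maxPaths L) where

    choices : Vec (List (Subset (L * 2))) (n * k)
    choices = replicate (n * k) (maxPaths L) [ b ]≔ (B ∷ [])

    pinned : List (Subset order)
    pinned = map (assemble inside ⊥) (cover 0 choices)

    lookup-choices : ∀ c → lookup choices c ≡ B ∷ [] × c ≡ b ⊎ lookup choices c ≡ maxPaths L
    lookup-choices c with c Fin.≟ b
    ... | yes refl = inj₁ (lookup∘update b (replicate (n * k) (maxPaths L)) (B ∷ []) , refl)
    ... | no  c≢b  = inj₂ (trans (lookup∘update′ c≢b (replicate (n * k) (maxPaths L)) (B ∷ []))
                                 (lookup-replicate c (maxPaths L)))

    unique-pinned : Unique pinned
    unique-pinned = Unique.map⁺ (λ {Bs} {Bs′} → assemble-injective {inside} {⊥} {Bs} {Bs′})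
                                (unique-cover-zero choices unique)
      where
      unique : ∀ c → Unique (lookup choices c)
      unique c with lookup-choices c
      ... | inj₁ (eq , _) = subst Unique (sym eq) ([] ∷ [])
      ... | inj₂ eq       = subst Unique (sym eq) (unique-maxPaths L)

    length-pinned : length pinned * N ≡ N ^ (n * k)
    length-pinned = begin
      length pinned * N
        ≡⟨ cong (_* N) (trans (length-map _ (cover 0 choices)) (length-cover-zero choices)) ⟩
      weight choices * N
        ≡⟨ cong (weight choices *_) (trans (cong length (lookup-replicate b (maxPaths L))) (length-maxPaths L)) ⟨
      weight choices * length (lookup (replicate (n * k) (maxPaths L)) b)
        ≡⟨ weight-update (replicate (n * k) (maxPaths L)) b (B ∷ []) ⟩
      1 * weight (replicate (n * k) (maxPaths L))
        ≡⟨ *-identityˡ _ ⟩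
      weight (replicate (n * k) (maxPaths L))
        ≡⟨ weight-replicate (n * k) (maxPaths L) ⟩
      length (maxPaths L) ^ (n * k)
        ≡⟨ cong (_^ (n * k)) (length-maxPaths L) ⟩
      N ^ (n * k)
        ∎
      where open ≡-Reasoning

    ∈-pinned⁻ : ∀ {S} → S ∈ˡ pinned →
                ∃[ Bs ] S ≡ assemble inside ⊥ Bs × lookup Bs b ≡ B × (∀ c → lookup Bs c ∈ˡ maxPaths L)
    ∈-pinned⁻ S∈ with ∈-map⁻ (assemble inside ⊥) S∈
    ... | Bs , Bs∈ , refl = Bs , refl , at-b , max
      where
      at-b : lookup Bs b ≡ B
      at-b with here eq ← subst (lookup Bs b ∈ˡ_)
                            (lookup∘update b (replicate (n * k) (maxPaths L)) (B ∷ []))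
                            (∈-cover-zero⁻ choices Bs∈ b) = eq
      max : ∀ c → lookup Bs c ∈ˡ maxPaths L
      max c with lookup-choices c
      ... | inj₁ (_ , refl) = subst (_∈ˡ maxPaths L) (sym at-b) B∈
      ... | inj₂ eq         = subst (lookup Bs c ∈ˡ_) eq (∈-cover-zero⁻ choices Bs∈ c)

    pinned⊆star : ∀ {S} → S ∈ˡ pinned → InStar tree r zero S
    pinned⊆star S∈ with ∈-pinned⁻ S∈
    ... | Bs , refl , _ , max =
      assemble-independent {Bs} (λ c → maxPath-pathIndependent L (max c)) ,
      trans (∣assemble-inside∣ Bs) (cong suc (∣concat∣-≡ Bs (λ c → ∣maxPath∣ L (max c)))) ,
      here

    -- The bound on `avoiders` carries the factor `N ^ k`, the count of `pinned` the factor `N`;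
    -- both sides are therefore multiplied by `N * N ^ k`, which is cancelled at the end.
    avoiders<pinned : 1 ≤ L → N * 2 ^ n * exceptions < 2 ^ k → length avoiders < length pinned
    avoiders<pinned 1≤L small = *-cancelʳ-< (N * N ^ k) (length avoiders) (length pinned) (begin-strict
      length avoiders * (N * N ^ k)
        ≡⟨ solve 3 (λ a m p → a :* (m :* p) := m :* (a :* p)) refl (length avoiders) N (N ^ k) ⟩
      N * (length avoiders * N ^ k)
        ≤⟨ *-monoʳ-≤ N length-avoiders-≤ ⟩
      N * (2 ^ n * (N ^ (n * k) * exceptions))
        ≡⟨ solve 4 (λ m t q e → m :* (t :* (q :* e)) := q :* (m :* t :* e)) refl
             N (2 ^ n) (N ^ (n * k)) exceptions ⟩
      N ^ (n * k) * (N * 2 ^ n * exceptions)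
        <⟨ *-monoʳ-< (N ^ (n * k)) ⦃ m^n≢0 N (n * k) ⦄ small ⟩
      N ^ (n * k) * 2 ^ k
        -- `1 ≤ L` means `2 ≤ N`, so `N ^ k` is at least the exponential `2 ^ k`.
        ≤⟨ *-monoʳ-≤ (N ^ (n * k)) (^-monoˡ-≤ k (s≤s 1≤L)) ⟩
      N ^ (n * k) * N ^ k
        ≡⟨ cong (_* N ^ k) length-pinned ⟨
      length pinned * N * N ^ k
        ≡⟨ *-assoc (length pinned) N (N ^ k) ⟩
      length pinned * (N * N ^ k)
        ∎)
      where
      open ≤-Reasoning
      open +-*-Solver

    -- Sets containing both `w` and the root count for both stars. The rest of the star of `w` lies
    -- in `avoiders`, whereas the star of the root also contains the `pinned` sets, which miss `w`
    -- and are more numerous.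
    star<root-star : ∀ w → 1 ≤ L → N * 2 ^ n * exceptions < 2 ^ k →
                     (∀ {Bs} → lookup Bs b ≡ B → w ∉ assemble inside ⊥ Bs) →
                     starSize tree r w < starSize tree r zero
    star<root-star w 1≤L small w∉ = begin-strict
      starSize tree r w                 ≤⟨ length-⊆ unique-star star⊆ ⟩
      length (both ++ avoiders)         ≡⟨ length-++ both ⟩
      length both + length avoiders     <⟨ +-monoʳ-< (length both) (avoiders<pinned 1≤L small) ⟩
      length both + length pinned       ≡⟨ length-++ both ⟨
      length (both ++ pinned)           ≤⟨ length-⊆ unique-both++pinned both++pinned⊆ ⟩
      starSize tree r zero              ∎
      where
      open ≤-Reasoning
      both : List (Subset order)
      both = filter (w ∈?_) (star tree r zero)

      unique-star : ∀ {v} → Unique (star tree r v)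
      unique-star {v} = Unique.filter⁺ (inStar? tree r v) (unique-subsets order)

      star⊆ : ∀ {S} → S ∈ˡ star tree r w → S ∈ˡ both ++ avoiders
      star⊆ {S} S∈ with ∈-filter⁻ (inStar? tree r w) {xs = subsets order} S∈ | zero ∈? S
      ... | S∈subsets , ind , size , w∈S | yes 0∈S = ∈-++⁺ˡ
        (∈-filter⁺ (w ∈?_) (∈-filter⁺ (inStar? tree r zero) S∈subsets (ind , size , 0∈S)) w∈S)
      ... | _         , ind , size , w∈S | no  0∉S = ∈-++⁺ʳ both (∈-avoiders ind size 0∉S)

      unique-both++pinned : Unique (both ++ pinned)
      unique-both++pinned = Unique.++⁺ (Unique.filter⁺ (w ∈?_) unique-star) unique-pinned disjoint
        where
        disjoint : ∀ {S} → ¬ (S ∈ˡ both × S ∈ˡ pinned)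
        disjoint (S∈both , S∈pinned) with ∈-pinned⁻ S∈pinned
        ... | Bs , refl , at-b , _ =
          w∉ {Bs} at-b (proj₂ (∈-filter⁻ (w ∈?_) {xs = star tree r zero} S∈both))

      both++pinned⊆ : ∀ {S} → S ∈ˡ both ++ pinned → S ∈ˡ star tree r zero
      both++pinned⊆ {S} S∈ with ∈-++⁻ both S∈
      ... | inj₁ S∈both   = proj₁ (∈-filter⁻ (w ∈?_) S∈both)
      ... | inj₂ S∈pinned = ∈-filter⁺ (inStar? tree r zero) (∈-subsets S) (pinned⊆star S∈pinned)

-- The root as centre, and the choice of parameters.

module _ (n k L : ℕ) where
  open SpiderStars n (suc k) L

  root-isCentre : 1 ≤ L → N * 2 ^ n * exceptions < 2 ^ suc k → IsCentreOfLargestStar tree r zero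
  root-isCentre 1≤L small w w≢0 with decode w in eq
  ... | root     = contradiction (trans (sym (encode-decode w)) (cong encode eq)) w≢0
  -- The `pinned` sets contain no hub at all, so any branch and any maximum set on it will do here.
  ... | hub i    = star<root-star w 1≤L small λ {Bs} _ w∈ → ∉⊥ (hub∈⁻ {inside} {⊥} {Bs}
    (subst (_∈ assemble inside ⊥ Bs) (trans (sym (encode-decode w)) (cong encode eq)) w∈))
    where open Pinned (combine i zero) (evens∈maxPaths L)
  -- The branch of `w` is pinned to a maximum set that misses `w`.
  ... | node b p with B , B∈ , p∉B ← maxPath-avoiding L p =
    star<root-star w 1≤L small λ {Bs} at-b w∈ → p∉B (subst (p ∈_) at-b (node∈⁻ {inside} {⊥} {Bs}
      (subst (_∈ assemble inside ⊥ Bs) (trans (sym (encode-decode w)) (cong encode eq)) w∈)))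
    where open Pinned b B∈

theorem1p4 : (n d : ℕ) → 2 ≤ n → 3 ≤ d →
    ∃[ r ] 1 ≤ r ×
    (Σ[ T ∈ Graph ] IsTree T ×
    (Σ[ v ∈ Graph.Vertex T ]
    IsCentreOfLargestStar T r v ×
    degree T v ≡ n ×
    (∀ w → IsLeaf T w → DistanceAtLeast T d v w)))
theorem1p4 n d@(suc d-1) 2≤n _
  -- With `L = d`, the constant is `N * 2 ^ n` and the exponent `n` is the number of exceptions. The
  -- positive witness becomes the number of branches per hub.
  with polynomial<exponential (suc d * 2 ^ n) (length (subsets (d * 2)) * n) n
... | suc k , _ , small =
  r , s≤s z≤n , tree , isTree , zero ,
  root-isCentre n k d (s≤s z≤n) small′ ,
  degree-root ,
  λ w leaf → _ , distance-root w , ≤-trans d≤ (leaf-depth {n} {k} 2≤n w leaf)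
  where
  open SpiderStars n (suc k) d
  small′ : N * 2 ^ n * exceptions < 2 ^ suc k
  small′ = subst (λ z → N * 2 ^ n * (1 + z) ^ n < 2 ^ suc k)
                 (*-assoc (length (subsets (d * 2))) n (suc k)) small
  -- A branch has `d * 2` vertices, so `l` in `leaf-depth` is `suc (d-1 * 2)` and the right-hand
  -- side is `1 + d * 2`.
  d≤ : d ≤ 2 + suc (d-1 * 2)
  d≤ = ≤-trans (m≤m*n d 2) (n≤1+n _)
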